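{- For every integer $l \ge 1$, the domination numbers of the fractal cubic networks satisfy $\gamma(FCN(l)) = 4\,\gamma(FCN(l-1)) - 2$.
   Context: Fractal cubic network: for an integer $l\ge 0$, $FCN(l)$ is the finite simple graph whose vertices are all binary strings of length $2l+2$, defined recursively as follows. $FCN(0)$ is the 4-cycle with vertices $00, 01, 11, 10$ in this cyclic order. For $l\ge 1$, $FCN(l)$ is obtained from the disjoint union of the four copies $ab\,\Vert\,FCN(l-1)$, $a,b\in\{0,1\}$ (each vertex string of $FCN(l-1)$ is prefixed by $ab$, adjacency inside a copy being that of $FCN(l-1)$), by adding the four edges $\{00w,10w\}$, $\{10w,11w\}$, $\{11w,01w\}$, $\{01w,00w\}$, where $w=10(01)^{l-1}$ is the string $10$ followed by $l-1$ repetitions of $01$. A dominating set of a graph $\Gamma$ is a set $D\subseteq V(\Gamma)$ such that every vertex of $\Gamma$ is in $D$ or adjacent to a vertex of $D$; $\gamma(\Gamma)$ is the minimum size of a dominating set. -}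

module Defs where

open import Data.Fin using (Fin; suc)
open import Data.Fin.Patterns using (0F; 1F)
import Data.Fin.Properties as Fin
open import Data.Fin.Subset using (Subset; ⊤; ∣_∣; _∈_)
open import Data.Fin.Subset.Properties using (∈⊤; _∈?_; anySubset?)
open import Data.List using (List; []; _∷_)
open import Data.List.Membership.Propositional using () renaming (_∈_ to _∈ˡ_)
import Data.List.Membership.DecPropositional as DecMembership
open import Data.List.Relation.Unary.All using (All; []; _∷_; lookup)
open import Data.Nat using (ℕ; zero; suc; _+_; _*_; _^_; _≤_; z≤n; s≤s)
import Data.Nat.Properties as ℕ
open import Data.Product using (∃; ∃-syntax; _×_; _,_; proj₁; proj₂)
open import Data.Product.Function.NonDependent.Propositional using (_×-↔_)
open import Data.Product.Properties using (≡-dec)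
open import Data.Sum using (_⊎_; inj₁; inj₂)
open import Data.Vec using (Vec; []; _∷_; concat; replicate)
import Data.Vec.Properties as Vec
open import Function using (_∘_; _↔_; Inverse; mk↔ₛ′)
open import Function.Properties.Inverse using (↔-refl; ↔-sym; ↔-trans)
open import Level using (0ℓ)
open import Relation.Binary.Construct.Closure.Symmetric using (SymClosure; fwd; bwd; symmetric)
open import Relation.Binary.Core using (Rel)
open import Relation.Binary.Definitions using (Decidable; DecidableEquality; Symmetric)
open import Relation.Binary.PropositionalEquality using (_≡_; _≢_; refl; subst; sym)
open import Relation.Nullary using (¬_; Dec; yes; no; contradiction)
open import Relation.Nullary.Decidable using (map′; _×-dec_; _⊎-dec_)
import Relation.Unary as U

record FiniteSimpleGraph : Set₁ where
  infix 4 _~_ _~?_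
  field
    Vertex : Set
    order  : ℕ
    index  : Vertex ↔ Fin order
    _~_    : Rel Vertex 0ℓ
    _~?_   : Decidable _~_
    ~-sym  : Symmetric _~_
    ~-irr  : ∀ {v} → ¬ v ~ v

module Domination (Γ : FiniteSimpleGraph) where
  open FiniteSimpleGraph Γ

  -- Sets of vertices are subsets of Fin order, transported along index.
  infix 4 _∈ᵛ_
  _∈ᵛ_ : Vertex → Subset order → Set
  v ∈ᵛ D = Inverse.to index v ∈ D

  Dominating : Subset order → Set
  Dominating D = ∀ v → v ∈ᵛ D ⊎ ∃[ u ] (u ∈ᵛ D × v ~ u)

  DominatingSetOfSize : ℕ → Set
  DominatingSetOfSize k = ∃[ D ] (Dominating D × ∣ D ∣ ≡ k)

  private
    at : Fin order → Vertex
    at = Inverse.from index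

    at-index : ∀ v → at (Inverse.to index v) ≡ v
    at-index = Inverse.strictlyInverseʳ index

    all-vertices? : ∀ {P : U.Pred Vertex 0ℓ} → U.Decidable P → Dec (∀ v → P v)
    all-vertices? {P} P? =
      map′ (λ f v → subst P (at-index v) (f (Inverse.to index v)))
           (λ f → f ∘ at) (Fin.all? (P? ∘ at))

    any-vertex? : ∀ {P : U.Pred Vertex 0ℓ} → U.Decidable P → Dec (∃ P)
    any-vertex? {P} P? =
      map′ (λ (i , p) → at i , p)
           (λ (v , p) → Inverse.to index v , subst P (sym (at-index v)) p)
           (Fin.any? (P? ∘ at))

  dominating? : U.Decidable Dominating
  dominating? D = all-vertices? λ v →
    (Inverse.to index v ∈? D)
      ⊎-dec any-vertex? λ u → (Inverse.to index u ∈? D) ×-dec (v ~? u)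

  dominatingSetOfSize? : U.Decidable DominatingSetOfSize
  dominatingSetOfSize? k = anySubset? λ D → dominating? D ×-dec (∣ D ∣ ℕ.≟ k)

  vertexSet : ∃ DominatingSetOfSize
  vertexSet = ∣ ⊤ {order} ∣ , ⊤ , (λ _ → inj₁ ∈⊤) , refl

Minimum : U.Pred ℕ 0ℓ → ℕ → Set
Minimum P m = P m × (∀ k → P k → m ≤ k)

minimum : ∀ {P : U.Pred ℕ 0ℓ} → U.Decidable P → ∃ P → ∃ (Minimum P)
minimum P? (n , p) = go P? n p
  where
  go : ∀ {P : U.Pred ℕ 0ℓ} → U.Decidable P → ∀ n → P n → ∃ (Minimum P)
  go P? zero    p = zero , p , λ _ _ → z≤n
  go P? (suc n) p with P? zero
  ... | yes p₀ = zero , p₀ , λ _ _ → z≤n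
  ... | no ¬p₀ with go (P? ∘ suc) n p
  ...   | m , pm , least = suc m , pm , λ
          { zero    p₀ → contradiction p₀ ¬p₀
          ; (suc k) pk → s≤s (least k pk)
          }

γ-minimum : (Γ : FiniteSimpleGraph) → ∃ (Minimum (Domination.DominatingSetOfSize Γ))
γ-minimum Γ = minimum dominatingSetOfSize? vertexSet
  where open Domination Γ

γ : FiniteSimpleGraph → ℕ
γ Γ = proj₁ (γ-minimum Γ)

γ-spec : ∀ Γ → Minimum (Domination.DominatingSetOfSize Γ) (γ Γ)
γ-spec Γ = proj₂ (γ-minimum Γ)

Bits : ℕ → Set
Bits = Vec (Fin 2)

bits↔ : ∀ n → Bits n ↔ Fin (2 ^ n)
bits↔ zero    = mk↔ₛ′ (λ _ → 0F) (λ _ → []) (λ { 0F → refl ; (suc ()) }) (λ { [] → refl })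
bits↔ (suc n) = ↔-trans uncons↔ (↔-trans (↔-refl ×-↔ bits↔ n) (↔-sym Fin.*↔×))
  where
  uncons↔ : Bits (suc n) ↔ (Fin 2 × Bits n)
  uncons↔ = mk↔ₛ′ (λ { (b ∷ v) → b , v }) (λ (b , v) → b ∷ v)
                  (λ _ → refl) (λ { (_ ∷ _) → refl })

_≟ᵇ_ : ∀ {n} → DecidableEquality (Bits n)
_≟ᵇ_ = Vec.≡-dec Fin._≟_

FCN-Vertex : ℕ → Set
FCN-Vertex l = Bits (2 + l * 2)

baseCycle : List (Bits 2 × Bits 2)
baseCycle = (0F ∷ 0F ∷ [] , 0F ∷ 1F ∷ [])
          ∷ (0F ∷ 1F ∷ [] , 1F ∷ 1F ∷ [])
          ∷ (1F ∷ 1F ∷ [] , 1F ∷ 0F ∷ [])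
          ∷ (1F ∷ 0F ∷ [] , 0F ∷ 0F ∷ [])
          ∷ []

linkCycle : List (Bits 2 × Bits 2)
linkCycle = (0F ∷ 0F ∷ [] , 1F ∷ 0F ∷ [])
          ∷ (1F ∷ 0F ∷ [] , 1F ∷ 1F ∷ [])
          ∷ (1F ∷ 1F ∷ [] , 0F ∷ 1F ∷ [])
          ∷ (0F ∷ 1F ∷ [] , 0F ∷ 0F ∷ [])
          ∷ []

-- 10(01)ˡ, the vertex of FCN l at which four copies of FCN l are linked.
port : ∀ l → FCN-Vertex l
port l = 1F ∷ 0F ∷ concat (replicate l (0F ∷ 1F ∷ []))

-- Each edge occurs in one orientation only; adjacency is the symmetric closure.
FCN-Edge : ∀ l → Rel (FCN-Vertex l) 0ℓ
FCN-Edge zero    u v = (u , v) ∈ˡ baseCycle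
FCN-Edge (suc l) (a ∷ b ∷ u) (c ∷ d ∷ v) =
    (a ≡ c × b ≡ d × FCN-Edge l u v)
  ⊎ ((a ∷ b ∷ [] , c ∷ d ∷ []) ∈ˡ linkCycle × u ≡ port l × v ≡ port l)

FCN-Adj : ∀ l → Rel (FCN-Vertex l) 0ℓ
FCN-Adj l = SymClosure (FCN-Edge l)

FCN-Edge? : ∀ l → Decidable (FCN-Edge l)
FCN-Edge? zero    u v = (u , v) ∈ˡ? baseCycle
  where open DecMembership (≡-dec _≟ᵇ_ _≟ᵇ_) renaming (_∈?_ to _∈ˡ?_)
FCN-Edge? (suc l) (a ∷ b ∷ u) (c ∷ d ∷ v) =
    (a Fin.≟ c ×-dec b Fin.≟ d ×-dec FCN-Edge? l u v)
  ⊎-dec (((a ∷ b ∷ [] , c ∷ d ∷ []) ∈ˡ? linkCycle) ×-dec u ≟ᵇ port l ×-dec v ≟ᵇ port l)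
  where open DecMembership (≡-dec _≟ᵇ_ _≟ᵇ_) renaming (_∈?_ to _∈ˡ?_)

FCN-Adj? : ∀ l → Decidable (FCN-Adj l)
FCN-Adj? l u v = map′ (λ { (inj₁ e) → fwd e ; (inj₂ e) → bwd e })
                      (λ { (fwd e) → inj₁ e ; (bwd e) → inj₂ e })
                      (FCN-Edge? l u v ⊎-dec FCN-Edge? l v u)

FCN-Edge-irr : ∀ l {v} → ¬ FCN-Edge l v v
FCN-Edge-irr zero e = lookup distinct e refl
  where
  distinct : All (λ (p , q) → p ≢ q) baseCycle
  distinct = (λ ()) ∷ (λ ()) ∷ (λ ()) ∷ (λ ()) ∷ []
FCN-Edge-irr (suc l) {_ ∷ _ ∷ _} (inj₁ (_ , _ , e)) = FCN-Edge-irr l e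
FCN-Edge-irr (suc l) {_ ∷ _ ∷ _} (inj₂ (e , _))     = lookup distinct e refl
  where
  distinct : All (λ (p , q) → p ≢ q) linkCycle
  distinct = (λ ()) ∷ (λ ()) ∷ (λ ()) ∷ (λ ()) ∷ []

FCN-Adj-irr : ∀ l {v} → ¬ FCN-Adj l v v
FCN-Adj-irr l (fwd e) = FCN-Edge-irr l e
FCN-Adj-irr l (bwd e) = FCN-Edge-irr l e

FCN : ℕ → FiniteSimpleGraph
FCN l = record
  { Vertex = FCN-Vertex l
  ; order  = 2 ^ (2 + l * 2)
  ; index  = bits↔ (2 + l * 2)
  ; _~_    = FCN-Adj l
  ; _~?_   = FCN-Adj? l
  ; ~-sym  = symmetric (FCN-Edge l)
  ; ~-irr  = FCN-Adj-irr l
  }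

{-# OPTIONS --safe #-}
-- Besides p = port l, single out the vertex q = corner l = (01)ˡ⁺¹.  The links
-- of the next level are at the copies of p, whereas port (suc l) and
-- corner (suc l) are the copies of q in the opposite quarters 10 and 01.
--
-- Lower bound: if D dominates every vertex other than p and q, then |D| is at
-- least N l minus the number of undominated vertices among p and q.  In the
-- step the four copies of p form a 4-cycle, and at most two of them are not
-- dominated within their own copy, whence N (suc l) = 4 N l − 2.
--
-- Upper bound: build simultaneously a dominating set of size N l containing
-- p and q, a set of size N l − 1 dominating all but p, and a set of size
-- N l − 1 containing p and dominating all but q.
module Submission where

open import Defs
open import Data.Nat using (ℕ; _≤_; _∸_)
open import Data.Integer using (+_; _*_; _-_)
open import Relation.Binary.PropositionalEquality using (_≡_)

open import Data.Bool using (Bool; true; false; if_then_else_)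
import Data.Bool.Properties as Bool
open import Data.Empty using (⊥-elim)
open import Data.Fin using (Fin; opposite; _↑ˡ_)
open import Data.Fin.Patterns using (0F; 1F)
open import Data.Fin.Subset using (Subset; ∣_∣)
open import Data.Integer using (_⊖_)
open import Data.Integer.Properties using (pos-*; ⊖-≥; m-n≡m⊖n)
open import Data.List.Membership.Propositional using () renaming (_∈_ to _∈ˡ_)
open import Data.List.Relation.Unary.Any using (here; there)
import Data.Nat as ℕ
open import Data.Nat using (zero; suc; z≤n; s≤s)
import Data.Nat.Properties as ℕ
open import Algebra.Properties.CommutativeSemigroup ℕ.+-commutativeSemigroup using (interchange)
open import Data.Nat.Solver using (module +-*-Solver)
open import Data.Product using (∃-syntax; _×_; _,_)
open import Data.Sum using (_⊎_; inj₁; inj₂; [_,_])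
open import Data.Vec using ([]; _∷_; _++_; concat; replicate; lookup; map; splitAt; tabulate)
open import Data.Vec.Properties using (lookup-++ˡ; lookup-++ʳ; lookup∘tabulate; []=⇒lookup; lookup⇒[]=)
open import Function using (_∘_; Inverse)
open import Relation.Binary.Construct.Closure.Symmetric using (SymClosure; fwd; bwd)
open import Relation.Binary.PropositionalEquality using (_≢_; refl; sym; trans; cong; cong₂; subst; module ≡-Reasoning)
open import Relation.Nullary using (¬_; Dec; yes; no)
open import Relation.Nullary.Decidable using (_⊎-dec_; from-no)

-- Cardinality of sets of bit strings given by Boolean predicates.

-- Recursion on the leading bits makes the size of a set of vertices at level `suc l` unfold, by
-- computation alone, to the sum of the sizes of its four quarters.
size : ∀ {n} → (Bits n → Bool) → ℕ
size {zero}  D = if D [] then 1 else 0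
size {suc n} D = size (D ∘ (0F ∷_)) ℕ.+ size (D ∘ (1F ∷_))

size-cong : ∀ {n} {D E : Bits n → Bool} → (∀ v → D v ≡ E v) → size D ≡ size E
size-cong {zero}  eq = cong (if_then 1 else 0) (eq [])
size-cong {suc n} eq = cong₂ ℕ._+_ (size-cong (eq ∘ (0F ∷_))) (size-cong (eq ∘ (1F ∷_)))

∣++∣ : ∀ {m n} (p : Subset m) (q : Subset n) → ∣ p ++ q ∣ ≡ ∣ p ∣ ℕ.+ ∣ q ∣
∣++∣ []          q = refl
∣++∣ (true  ∷ p) q = cong suc (∣++∣ p q)
∣++∣ (false ∷ p) q = ∣++∣ p q

indicator : ∀ n → Subset (2 ℕ.^ n) → Bits n → Bool
indicator n S v = lookup S (Inverse.to (bits↔ n) v)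

∣∣≡size : ∀ n (S : Subset (2 ℕ.^ n)) → ∣ S ∣ ≡ size (indicator n S)
∣∣≡size zero    (true  ∷ []) = refl
∣∣≡size zero    (false ∷ []) = refl
∣∣≡size (suc n) S with splitAt (2 ℕ.^ n) S
-- `2 ^ suc n` unfolds to `2 ^ n + (2 ^ n + 0)`, so the second split leaves an empty tail.
... | S₀ , S₀₁ , refl with splitAt (2 ℕ.^ n) S₀₁
... | S₁ , [] , refl = begin
  ∣ S₀ ++ S₁ ++ [] ∣          ≡⟨ ∣++∣ S₀ (S₁ ++ []) ⟩
  ∣ S₀ ∣ ℕ.+ ∣ S₁ ++ [] ∣     ≡⟨ cong (∣ S₀ ∣ ℕ.+_) (trans (∣++∣ S₁ []) (ℕ.+-identityʳ _)) ⟩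
  ∣ S₀ ∣ ℕ.+ ∣ S₁ ∣           ≡⟨ cong₂ ℕ._+_ (∣∣≡size n S₀) (∣∣≡size n S₁) ⟩
  size (indicator n S₀) ℕ.+ size (indicator n S₁)
                              ≡⟨ cong₂ ℕ._+_ (size-cong first) (size-cong second) ⟩
  size (indicator (suc n) (S₀ ++ S₁ ++ [])) ∎
  where
  open ≡-Reasoning
  first : ∀ v → indicator n S₀ v ≡ indicator (suc n) (S₀ ++ S₁ ++ []) (0F ∷ v)
  first v = sym (lookup-++ˡ S₀ (S₁ ++ []) _)
  second : ∀ v → indicator n S₁ v ≡ indicator (suc n) (S₀ ++ S₁ ++ []) (1F ∷ v)
  second v = sym (trans (lookup-++ʳ S₀ (S₁ ++ []) (Inverse.to (bits↔ n) v ↑ˡ 0)) (lookup-++ˡ S₁ [] _))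

-- Pointwise domination, and its passage between levels.

-- Stated one vertex at a time, because both bounds need sets that may miss the port or the corner.
Dominated : ∀ l → (FCN-Vertex l → Bool) → FCN-Vertex l → Set
Dominated l D v = D v ≡ true ⊎ ∃[ u ] (D u ≡ true × FCN-Adj l v u)

module _ (l : ℕ) where
  open Domination (FCN l)

  private
    dim : ℕ
    dim = 2 ℕ.+ l ℕ.* 2

    toSubset : (FCN-Vertex l → Bool) → Subset (2 ℕ.^ dim)
    toSubset D = tabulate (D ∘ Inverse.from (bits↔ dim))

    indicator-toSubset : ∀ D v → indicator dim (toSubset D) v ≡ D v
    indicator-toSubset D v =
      trans (lookup∘tabulate (D ∘ Inverse.from (bits↔ dim)) _) (cong D (Inverse.strictlyInverseʳ (bits↔ dim) v))

    ∈-toSubset : ∀ D {v} → D v ≡ true → v ∈ᵛ toSubset D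
    ∈-toSubset D {v} d = lookup⇒[]= _ _ (trans (indicator-toSubset D v) d)

  dominatingSet : ∀ D → (∀ v → Dominated l D v) → DominatingSetOfSize (size D)
  dominatingSet D dom =
      toSubset D
    , (λ v → [ inj₁ ∘ ∈-toSubset D , (λ (u , d , a) → inj₂ (u , ∈-toSubset D d , a)) ] (dom v))
    , trans (∣∣≡size dim (toSubset D)) (size-cong (indicator-toSubset D))

  dominatingIndicator : ∀ {k} → DominatingSetOfSize k →
                        ∃[ D ] ((∀ v → Dominated l D v) × size D ≡ k)
  dominatingIndicator (S , dom , refl) =
      indicator dim S
    , (λ v → [ inj₁ ∘ []=⇒lookup , (λ (u , d , a) → inj₂ (u , []=⇒lookup d , a)) ] (dom v))
    , sym (∣∣≡size dim S)

corner : ∀ l → FCN-Vertex l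
corner l = concat (replicate (suc l) (0F ∷ 1F ∷ []))

Quarter : Set
Quarter = Fin 2 × Fin 2

infixr 5 _∷∷_
_∷∷_ : ∀ {n} → Quarter → Bits n → Bits (2 ℕ.+ n)
(a , b) ∷∷ v = a ∷ b ∷ v

Linked : Quarter → Quarter → Set
Linked (a , b) (c , d) = SymClosure (λ x y → (x , y) ∈ˡ linkCycle) (a ∷ b ∷ []) (c ∷ d ∷ [])

lift : ∀ l D x {v} → Dominated l (D ∘ (x ∷∷_)) v → Dominated (suc l) D (x ∷∷ v)
lift l D x (inj₁ d)               = inj₁ d
lift l D x (inj₂ (u , d , fwd e)) = inj₂ (x ∷∷ u , d , fwd (inj₁ (refl , refl , e)))
lift l D x (inj₂ (u , d , bwd e)) = inj₂ (x ∷∷ u , d , bwd (inj₁ (refl , refl , e)))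

-- Edges between quarters join only copies of the port, so help from outside a quarter can reach no
-- other vertex.
restrict : ∀ l D x {v} → Dominated (suc l) D (x ∷∷ v) →
           Dominated l (D ∘ (x ∷∷_)) v ⊎
           (v ≡ port l × ∃[ y ] (Linked x y × D (y ∷∷ port l) ≡ true))
restrict l D x (inj₁ d) = inj₁ (inj₁ d)
restrict l D x (inj₂ (c ∷ d ∷ u , du , fwd (inj₁ (refl , refl , e)))) = inj₁ (inj₂ (u , du , fwd e))
restrict l D x (inj₂ (c ∷ d ∷ u , du , fwd (inj₂ (e , v≡ , refl))))   = inj₂ (v≡ , _ , fwd e , du)
restrict l D x (inj₂ (c ∷ d ∷ u , du , bwd (inj₁ (refl , refl , e)))) = inj₁ (inj₂ (u , du , bwd e))
restrict l D x (inj₂ (c ∷ d ∷ u , du , bwd (inj₂ (e , refl , v≡))))   = inj₂ (v≡ , _ , bwd e , du)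

restrict≢port : ∀ l D x {v} → v ≢ port l →
                Dominated (suc l) D (x ∷∷ v) → Dominated l (D ∘ (x ∷∷_)) v
restrict≢port l D x v≢p dom with restrict l D x dom
... | inj₁ inside    = inside
... | inj₂ (v≡p , _) = ⊥-elim (v≢p v≡p)

-- Upper bound: the recursive witnesses.

-- This is the claimed domination number minus 2; the offset keeps all three witness sizes free of
-- subtraction.
excess : ℕ → ℕ
excess zero    = 0
excess (suc l) = 4 ℕ.+ 4 ℕ.* excess l

N : ℕ → ℕ
N l = 2 ℕ.+ excess l

data Kind : Set where
  full noPort noCorner : Kind

-- Quarters 00 and 11 may always miss their ports, since quarter 10 contains its port in every kind
-- and is linked to both. The corners of quarters 10 and 01 are the new port and corner, so
-- `noCorner` is placed exactly where the new vertex may be missed.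
kindOf : Kind → Quarter → Kind
kindOf full     (1F , 0F) = full
kindOf full     (0F , 1F) = full
kindOf noPort   (1F , 0F) = noCorner
kindOf noPort   (0F , 1F) = full
kindOf noCorner (1F , 0F) = full
kindOf noCorner (0F , 1F) = noCorner
kindOf _        _         = noPort

witness : ∀ l → Kind → FCN-Vertex l → Bool
witness zero full     (0F ∷ 1F ∷ []) = true
witness zero full     (1F ∷ 0F ∷ []) = true
witness zero noPort   (0F ∷ 1F ∷ []) = true
witness zero noCorner (1F ∷ 0F ∷ []) = true
witness zero _        _              = false
witness (suc l) k (a ∷ b ∷ v)        = witness l (kindOf k (a , b)) v

corner∈full : ∀ l → witness l full (corner l) ≡ true
corner∈full zero    = refl
corner∈full (suc l) = corner∈full l

port∈full : ∀ l → witness l full (port l) ≡ true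
port∈full zero    = refl
port∈full (suc l) = corner∈full l

port∈noCorner : ∀ l → witness l noCorner (port l) ≡ true
port∈noCorner zero    = refl
port∈noCorner (suc l) = corner∈full l

port∈kindOf-10 : ∀ k l → witness l (kindOf k (1F , 0F)) (port l) ≡ true
port∈kindOf-10 full     = port∈full
port∈kindOf-10 noPort   = port∈noCorner
port∈kindOf-10 noCorner = port∈full

Exempt : Kind → ∀ l → FCN-Vertex l → Set
Exempt k l v = (k ≡ noPort × v ≡ port l) ⊎ (k ≡ noCorner × v ≡ corner l)

private
  edge₁ : (0F ∷ 0F ∷ [] , 0F ∷ 1F ∷ []) ∈ˡ baseCycle
  edge₁ = here refl
  edge₂ : (0F ∷ 1F ∷ [] , 1F ∷ 1F ∷ []) ∈ˡ baseCycle
  edge₂ = there (here refl)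
  edge₃ : (1F ∷ 1F ∷ [] , 1F ∷ 0F ∷ []) ∈ˡ baseCycle
  edge₃ = there (there (here refl))
  edge₄ : (1F ∷ 0F ∷ [] , 0F ∷ 0F ∷ []) ∈ˡ baseCycle
  edge₄ = there (there (there (here refl)))

-- By induction, a vertex missed inside a quarter is either its port, which a link from quarter 10
-- repairs, or its corner, which is then the vertex that the larger witness may miss.
witness-dominates : ∀ k l v → Dominated l (witness l k) v ⊎ Exempt k l v
witness-dominates full     zero (0F ∷ 0F ∷ []) = inj₁ (inj₂ (_ , refl , fwd edge₁))
witness-dominates full     zero (0F ∷ 1F ∷ []) = inj₁ (inj₁ refl)
witness-dominates full     zero (1F ∷ 0F ∷ []) = inj₁ (inj₁ refl)
witness-dominates full     zero (1F ∷ 1F ∷ []) = inj₁ (inj₂ (_ , refl , fwd edge₃))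
witness-dominates noPort   zero (0F ∷ 0F ∷ []) = inj₁ (inj₂ (_ , refl , fwd edge₁))
witness-dominates noPort   zero (0F ∷ 1F ∷ []) = inj₁ (inj₁ refl)
witness-dominates noPort   zero (1F ∷ 0F ∷ []) = inj₂ (inj₁ (refl , refl))
witness-dominates noPort   zero (1F ∷ 1F ∷ []) = inj₁ (inj₂ (_ , refl , bwd edge₂))
witness-dominates noCorner zero (0F ∷ 0F ∷ []) = inj₁ (inj₂ (_ , refl , bwd edge₄))
witness-dominates noCorner zero (0F ∷ 1F ∷ []) = inj₂ (inj₂ (refl , refl))
witness-dominates noCorner zero (1F ∷ 0F ∷ []) = inj₁ (inj₁ refl)
witness-dominates noCorner zero (1F ∷ 1F ∷ []) = inj₁ (inj₂ (_ , refl , fwd edge₃))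
witness-dominates k (suc l) (a ∷ b ∷ v) with witness-dominates (kindOf k (a , b)) l v
... | inj₁ inside = inj₁ (lift l (witness (suc l) k) (a , b) inside)
... | inj₂ (inj₁ (k≡ , refl)) = inj₁ (viaLink k (a , b) k≡)
  where
  viaLink : ∀ k x → kindOf k x ≡ noPort →
            Dominated (suc l) (witness (suc l) k) (x ∷∷ port l)
  viaLink k        (0F , 0F) _ =
    inj₂ (_ , port∈kindOf-10 k l , fwd (inj₂ (here refl , refl , refl)))
  viaLink k        (1F , 1F) _ =
    inj₂ (_ , port∈kindOf-10 k l , bwd (inj₂ (there (here refl) , refl , refl)))
  viaLink full     (0F , 1F) ()
  viaLink full     (1F , 0F) ()
  viaLink noPort   (0F , 1F) ()
  viaLink noPort   (1F , 0F) ()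
  viaLink noCorner (0F , 1F) ()
  viaLink noCorner (1F , 0F) ()
... | inj₂ (inj₂ (k≡ , refl)) = inj₂ (exempt k (a , b) k≡)
  where
  exempt : ∀ k x → kindOf k x ≡ noCorner → Exempt k (suc l) (x ∷∷ corner l)
  exempt noPort   (1F , 0F) _ = inj₁ (refl , refl)
  exempt noCorner (0F , 1F) _ = inj₂ (refl , refl)
  exempt full     (0F , 0F) ()
  exempt full     (0F , 1F) ()
  exempt full     (1F , 0F) ()
  exempt full     (1F , 1F) ()
  exempt noPort   (0F , 0F) ()
  exempt noPort   (0F , 1F) ()
  exempt noPort   (1F , 1F) ()
  exempt noCorner (0F , 0F) ()
  exempt noCorner (1F , 0F) ()
  exempt noCorner (1F , 1F) ()

witnessSize : Kind → ℕ → ℕ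
witnessSize full m = 2 ℕ.+ m
witnessSize _    m = 1 ℕ.+ m

size-witness : ∀ l k → size (witness l k) ≡ witnessSize k (excess l)
size-witness zero full     = refl
size-witness zero noPort   = refl
size-witness zero noCorner = refl
size-witness (suc l) k = begin
  size (witness (suc l) k)
    ≡⟨ cong₂ ℕ._+_ (cong₂ ℕ._+_ (at 0F 0F) (at 0F 1F)) (cong₂ ℕ._+_ (at 1F 0F) (at 1F 1F)) ⟩
  (w 0F 0F ℕ.+ w 0F 1F) ℕ.+ (w 1F 0F ℕ.+ w 1F 1F)
    ≡⟨ total k ⟩
  witnessSize k (excess (suc l)) ∎
  where
  open ≡-Reasoning
  open +-*-Solver
  w : Fin 2 → Fin 2 → ℕ
  w a b = witnessSize (kindOf k (a , b)) (excess l)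
  at : ∀ a b → size (witness l (kindOf k (a , b))) ≡ w a b
  at a b = size-witness l (kindOf k (a , b))
  -- The constants over the quarters add up to 1 + 2 + 2 + 1 for `full` and to 5 for the other
  -- kinds.
  total : ∀ k → let s = λ a b → witnessSize (kindOf k (a , b)) (excess l) in
          (s 0F 0F ℕ.+ s 0F 1F) ℕ.+ (s 1F 0F ℕ.+ s 1F 1F) ≡ witnessSize k (excess (suc l))
  total full = solve 1 (λ m → ((con 1 :+ m) :+ (con 2 :+ m)) :+ ((con 2 :+ m) :+ (con 1 :+ m))
                              := con 6 :+ con 4 :* m) refl (excess l)
  total noPort = solve 1 (λ m → ((con 1 :+ m) :+ (con 2 :+ m)) :+ ((con 1 :+ m) :+ (con 1 :+ m))
                                := con 5 :+ con 4 :* m) refl (excess l)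
  total noCorner = solve 1 (λ m → ((con 1 :+ m) :+ (con 1 :+ m)) :+ ((con 2 :+ m) :+ (con 1 :+ m))
                                  := con 5 :+ con 4 :* m) refl (excess l)

-- Lower bound: domination with slack.

-- The index is a cost: 0 has to be justified by a proof of `P`, while 1 is always permitted, even
-- when `P` holds. Costs can therefore be rounded up to a fixed total.
data Slack (P : Set) : ℕ → Set where
  tight : P → Slack P 0
  loose : Slack P 1

slack-map : ∀ {P Q : Set} {s} → (P → Q) → Slack P s → Slack Q s
slack-map f (tight p) = tight (f p)
slack-map f loose     = loose

-- P₁, P₂ and Q₁, Q₂ concern the two pairs of opposite quarters of the link
-- cycle; U and V say that the respective pair contains a linking vertex of D.
at-most-two-loose : ∀ {P₁ P₂ Q₁ Q₂ U V : Set} → Dec U → Dec V →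
  (U → P₁ ⊎ P₂) → (V → Q₁ ⊎ Q₂) → (¬ V → P₁ × P₂) → (¬ U → Q₁ × Q₂) →
  ∃[ s₁ ] ∃[ s₂ ] ∃[ t₁ ] ∃[ t₂ ]
    (Slack P₁ s₁ × Slack P₂ s₂ × Slack Q₁ t₁ × Slack Q₂ t₂ × (s₁ ℕ.+ s₂) ℕ.+ (t₁ ℕ.+ t₂) ≡ 2)
at-most-two-loose (yes u) (yes v) P Q _ _ with P u | Q v
... | inj₁ p | inj₁ q = _ , _ , _ , _ , tight p , loose , tight q , loose , refl
... | inj₁ p | inj₂ q = _ , _ , _ , _ , tight p , loose , loose , tight q , refl
... | inj₂ p | inj₁ q = _ , _ , _ , _ , loose , tight p , tight q , loose , refl
... | inj₂ p | inj₂ q = _ , _ , _ , _ , loose , tight p , loose , tight q , refl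
at-most-two-loose _ (no ¬v) _ _ P _ = let p₁ , p₂ = P ¬v in
  _ , _ , _ , _ , tight p₁ , tight p₂ , loose , loose , refl
at-most-two-loose (no ¬u) _ _ _ _ Q = let q₁ , q₂ = Q ¬u in
  _ , _ , _ , _ , loose , loose , tight q₁ , tight q₂ , refl


size≥1 : ∀ {n} {D : Bits n → Bool} v → D v ≡ true → 1 ≤ size D
size≥1 []       d rewrite d = s≤s z≤n
size≥1 (0F ∷ v) d = ℕ.≤-trans (size≥1 v d) (ℕ.m≤m+n _ _)
size≥1 (1F ∷ v) d = ℕ.≤-trans (size≥1 v d) (ℕ.m≤n+m _ _)

size≥2 : ∀ {n} {D : Bits n → Bool} u v → u ≢ v → D u ≡ true → D v ≡ true → 2 ≤ size D
size≥2 []       []       u≢v _ _ = ⊥-elim (u≢v refl)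
size≥2 (0F ∷ u) (0F ∷ v) u≢v d e = ℕ.≤-trans (size≥2 u v (u≢v ∘ cong (0F ∷_)) d e) (ℕ.m≤m+n _ _)
size≥2 (0F ∷ u) (1F ∷ v) _   d e = ℕ.+-mono-≤ (size≥1 u d) (size≥1 v e)
size≥2 (1F ∷ u) (0F ∷ v) _   d e = ℕ.+-mono-≤ (size≥1 v e) (size≥1 u d)
size≥2 (1F ∷ u) (1F ∷ v) u≢v d e = ℕ.≤-trans (size≥2 u v (u≢v ∘ cong (1F ∷_)) d e) (ℕ.m≤n+m _ _)

dominator : ∀ l {D v} → Dominated l D v → ∃[ u ] (D u ≡ true × (v ≡ u ⊎ FCN-Adj l v u))
dominator l (inj₁ d)           = _ , d , inj₁ refl
dominator l (inj₂ (u , d , a)) = u , d , inj₂ a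

dominated⇒size≥1 : ∀ l {D v} → Dominated l D v → 1 ≤ size D
dominated⇒size≥1 l {D} dom = let u , d , _ = dominator l dom in size≥1 {D = D} u d

antipode : Bits 2 → Bits 2
antipode = map opposite

antipode-near? : ∀ u → Dec (antipode u ≡ u ⊎ FCN-Adj 0 (antipode u) u)
antipode-near? u = (antipode u ≟ᵇ u) ⊎-dec FCN-Adj? 0 (antipode u) u

-- Opposite vertices of a 4-cycle are distinct and not adjacent; the four cases are settled by the
-- decision procedure.
antipode-far : ∀ u → ¬ (antipode u ≡ u ⊎ FCN-Adj 0 (antipode u) u)
antipode-far (0F ∷ 0F ∷ []) = from-no (antipode-near? (0F ∷ 0F ∷ []))
antipode-far (0F ∷ 1F ∷ []) = from-no (antipode-near? (0F ∷ 1F ∷ []))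
antipode-far (1F ∷ 0F ∷ []) = from-no (antipode-near? (1F ∷ 0F ∷ []))
antipode-far (1F ∷ 1F ∷ []) = from-no (antipode-near? (1F ∷ 1F ∷ []))

-- Any member `u` leaves its antipode undominated, so the antipode needs a second member.
dominating⇒size≥2 : ∀ {D} → (∀ v → Dominated 0 D v) → 2 ≤ size D
dominating⇒size≥2 {D} dom with dominator 0 (dom (port 0))
... | u , d , _ with dominator 0 (dom (antipode u))
... | w , e , near = size≥2 u w (λ { refl → antipode-far u near }) d e

-- The link cycle is bipartite with parts 00, 11 and 10, 01: each quarter is linked to exactly the
-- two quarters of the other part. The next three lemmas treat the other quarters.
linked-00 : ∀ {y} → Linked (0F , 0F) y → y ≡ (1F , 0F) ⊎ y ≡ (0F , 1F)
linked-00 (fwd (here refl))                         = inj₁ refl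
linked-00 (fwd (there (there (there (there ())))))
linked-00 (bwd (there (there (there (here refl))))) = inj₂ refl

linked-11 : ∀ {y} → Linked (1F , 1F) y → y ≡ (1F , 0F) ⊎ y ≡ (0F , 1F)
linked-11 (fwd (there (there (here refl)))) = inj₂ refl
linked-11 (fwd (there (there (there (here ())))))
linked-11 (bwd (there (here refl)))         = inj₁ refl
linked-11 (bwd (there (there (there (there ())))))

linked-10 : ∀ {y} → Linked (1F , 0F) y → y ≡ (0F , 0F) ⊎ y ≡ (1F , 1F)
linked-10 (fwd (there (here refl))) = inj₂ refl
linked-10 (fwd (there (there (there (there ())))))
linked-10 (bwd (here refl))         = inj₁ refl
linked-10 (bwd (there (there (there (there ())))))

linked-01 : ∀ {y} → Linked (0F , 1F) y → y ≡ (0F , 0F) ⊎ y ≡ (1F , 1F)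
linked-01 (fwd (there (there (there (here refl))))) = inj₁ refl
linked-01 (bwd (there (there (here refl))))         = inj₂ refl
linked-01 (bwd (there (there (there (here ())))))

-- Induction applies the bound to each quarter. The corners of quarters 10 and 01 inherit the slacks
-- `s` and `t`, those of 00 and 11 have none, and the four ports together cost 2.
lower : ∀ l D → (∀ v → v ≢ port l → v ≢ corner l → Dominated l D v) →
        ∀ {s t} → Slack (Dominated l D (port l)) s → Slack (Dominated l D (corner l)) t →
        N l ≤ size D ℕ.+ (s ℕ.+ t)
lower zero D dom (tight p) (tight q) =
  subst (2 ≤_) (sym (ℕ.+-identityʳ _)) (dominating⇒size≥2 everywhere)
  where
  everywhere : ∀ v → Dominated 0 D v
  everywhere (0F ∷ 0F ∷ []) = dom _ (λ ()) (λ ())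
  everywhere (0F ∷ 1F ∷ []) = q
  everywhere (1F ∷ 0F ∷ []) = p
  everywhere (1F ∷ 1F ∷ []) = dom _ (λ ()) (λ ())
-- One unit of slack pays for one vertex; the dominated port or corner still forces one member.
lower zero D dom (tight p) loose     = ℕ.+-monoˡ-≤ 1 (dominated⇒size≥1 0 p)
lower zero D dom loose     (tight q) = ℕ.+-monoˡ-≤ 1 (dominated⇒size≥1 0 q)
lower zero D dom loose     loose     = ℕ.m≤n+m 2 (size D)
lower (suc l) D dom {s} {t} slackP slackQ =
  combine (at-most-two-loose (linking? (0F , 0F) (1F , 1F)) (linking? (1F , 0F) (0F , 1F))
    -- A linking vertex dominates itself inside its quarter. If a pair has no linking vertex, both
    -- ports of the opposite pair get no help through links.
    linking⇒inside linking⇒inside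
    (λ none → unlinked linked-00 none , unlinked linked-11 none)
    (λ none → unlinked linked-10 none , unlinked linked-01 none))
  where
  Inside : Quarter → Set
  Inside x = Dominated l (D ∘ (x ∷∷_)) (port l)

  Linking : Quarter → Quarter → Set
  Linking x y = D (x ∷∷ port l) ≡ true ⊎ D (y ∷∷ port l) ≡ true

  linking? : ∀ x y → Dec (Linking x y)
  linking? x y = (D (x ∷∷ port l) Bool.≟ true) ⊎-dec (D (y ∷∷ port l) Bool.≟ true)

  linking⇒inside : ∀ {x y} → Linking x y → Inside x ⊎ Inside y
  linking⇒inside (inj₁ d) = inj₁ (inj₁ d)
  linking⇒inside (inj₂ d) = inj₂ (inj₁ d)

  unlinked : ∀ {x y z} → (∀ {w} → Linked x w → w ≡ y ⊎ w ≡ z) → ¬ Linking y z → Inside x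
  -- A copy of `port l` is neither the new port nor the new corner, as both of these are copies of
  -- `corner l`; hence `dom` applies.
  unlinked {x} nbr none with restrict l D x (dom (x ∷∷ port l) (λ ()) (λ ()))
  ... | inj₁ inside = inside
  ... | inj₂ (_ , w , lk , d) with nbr lk
  ...   | inj₁ refl = ⊥-elim (none (inj₁ d))
  ...   | inj₂ refl = ⊥-elim (none (inj₂ d))

  domInside : ∀ x v → v ≢ port l → v ≢ corner l → Dominated l (D ∘ (x ∷∷_)) v
  domInside x v v≢p v≢q = restrict≢port l D x v≢p
    (dom (x ∷∷ v) (λ { refl → v≢q refl }) (λ { refl → v≢q refl }))

  quarter : ∀ x {i j} → Slack (Inside x) i → Slack (Dominated (suc l) D (x ∷∷ corner l)) j →
            N l ≤ size (D ∘ (x ∷∷_)) ℕ.+ (i ℕ.+ j)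
  quarter x slack-p slack-q =
    -- The corner differs from the port in its first bit, so its domination never comes through a
    -- link.
    lower l (D ∘ (x ∷∷_)) (domInside x) slack-p (slack-map (restrict≢port l D x (λ ())) slack-q)

  combine : ∃[ s₁ ] ∃[ s₂ ] ∃[ t₁ ] ∃[ t₂ ]
    (Slack (Inside (0F , 0F)) s₁ × Slack (Inside (1F , 1F)) s₂ ×
     Slack (Inside (1F , 0F)) t₁ × Slack (Inside (0F , 1F)) t₂ × (s₁ ℕ.+ s₂) ℕ.+ (t₁ ℕ.+ t₂) ≡ 2) →
    N (suc l) ≤ size D ℕ.+ (s ℕ.+ t)
  -- Adding 2 to both sides avoids subtraction: the left becomes four times `N l`, and on the right
  -- 2 is the total slack of the ports.
  combine (s₁ , s₂ , t₁ , t₂ , S₁ , S₂ , T₁ , T₂ , two) = ℕ.+-cancelˡ-≤ 2 _ _ (begin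
    2 ℕ.+ N (suc l)
      ≡⟨ solve 1 (λ m → con 8 :+ con 4 :* m
                    := ((con 2 :+ m) :+ (con 2 :+ m)) :+ ((con 2 :+ m) :+ (con 2 :+ m))) refl (excess l) ⟩
    (N l ℕ.+ N l) ℕ.+ (N l ℕ.+ N l)
      ≤⟨ ℕ.+-mono-≤ (ℕ.+-mono-≤ (quarter (0F , 0F) S₁ (tight (dom _ (λ ()) (λ ()))))
                                (quarter (0F , 1F) T₂ slackQ))
                    (ℕ.+-mono-≤ (quarter (1F , 0F) T₁ slackP)
                                (quarter (1F , 1F) S₂ (tight (dom _ (λ ()) (λ ()))))) ⟩
    ((x₀₀ ℕ.+ (s₁ ℕ.+ 0)) ℕ.+ (x₀₁ ℕ.+ (t₂ ℕ.+ t))) ℕ.+ ((x₁₀ ℕ.+ (t₁ ℕ.+ s)) ℕ.+ (x₁₁ ℕ.+ (s₂ ℕ.+ 0)))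
      ≡⟨ cong₂ ℕ._+_ (interchange x₀₀ _ x₀₁ _) (interchange x₁₀ _ x₁₁ _) ⟩
    ((x₀₀ ℕ.+ x₀₁) ℕ.+ ((s₁ ℕ.+ 0) ℕ.+ (t₂ ℕ.+ t))) ℕ.+ ((x₁₀ ℕ.+ x₁₁) ℕ.+ ((t₁ ℕ.+ s) ℕ.+ (s₂ ℕ.+ 0)))
      ≡⟨ interchange (x₀₀ ℕ.+ x₀₁) _ (x₁₀ ℕ.+ x₁₁) _ ⟩
    size D ℕ.+ (((s₁ ℕ.+ 0) ℕ.+ (t₂ ℕ.+ t)) ℕ.+ ((t₁ ℕ.+ s) ℕ.+ (s₂ ℕ.+ 0)))
      ≡⟨ solve 7 (λ x s₁ s₂ t₁ t₂ s t →
           x :+ (((s₁ :+ con 0) :+ (t₂ :+ t)) :+ ((t₁ :+ s) :+ (s₂ :+ con 0)))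
           := ((s₁ :+ s₂) :+ (t₁ :+ t₂)) :+ (x :+ (s :+ t)))
           refl (size D) s₁ s₂ t₁ t₂ s t ⟩
    ((s₁ ℕ.+ s₂) ℕ.+ (t₁ ℕ.+ t₂)) ℕ.+ (size D ℕ.+ (s ℕ.+ t))
      ≡⟨ cong (ℕ._+ (size D ℕ.+ (s ℕ.+ t))) two ⟩
    2 ℕ.+ (size D ℕ.+ (s ℕ.+ t)) ∎)
    where
    open ℕ.≤-Reasoning
    open +-*-Solver
    x₀₀ = size (D ∘ ((0F , 0F) ∷∷_))
    x₀₁ = size (D ∘ ((0F , 1F) ∷∷_))
    x₁₀ = size (D ∘ ((1F , 0F) ∷∷_))
    x₁₁ = size (D ∘ ((1F , 1F) ∷∷_))

-- The exact domination number and its recurrence.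

Minimum-unique : ∀ {P : ℕ → Set} {m n} → Minimum P m → Minimum P n → m ≡ n
Minimum-unique (pm , m≤) (pn , n≤) = ℕ.≤-antisym (m≤ _ pn) (n≤ _ pm)

-- The `full` witness attains the value; a genuine dominating set has no slack at port or corner, so
-- `lower` gives minimality.
N-minimum : ∀ l → Minimum (Domination.DominatingSetOfSize (FCN l)) (N l)
N-minimum l = attained , least
  where
  dominates : ∀ v → Dominated l (witness l full) v
  dominates v with witness-dominates full l v
  ... | inj₁ dom             = dom
  ... | inj₂ (inj₁ (() , _))
  ... | inj₂ (inj₂ (() , _))

  attained : Domination.DominatingSetOfSize (FCN l) (N l)
  attained = subst (Domination.DominatingSetOfSize (FCN l)) (size-witness l full)
                   (dominatingSet l (witness l full) dominates)

  least : ∀ k → Domination.DominatingSetOfSize (FCN l) k → N l ≤ k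
  least k set = let D , dom , size≡k = dominatingIndicator l set in
    subst (N l ≤_) (trans (ℕ.+-identityʳ _) size≡k)
      (lower l D (λ v _ _ → dom v) (tight (dom (port l))) (tight (dom (corner l))))

γ-FCN : ∀ l → γ (FCN l) ≡ N l
γ-FCN l = Minimum-unique (γ-spec (FCN l)) (N-minimum l)

N-recurrence : ∀ l → + N (suc l) ≡ + 4 * + N l - + 2
N-recurrence l = begin
  + N (suc l)             ≡⟨ cong (λ n → + (n ∸ 2)) step ⟨
  -- Since 4 times `N l` is at least 2, truncated and integer subtraction agree.
  + (4 ℕ.* N l ∸ 2)       ≡⟨ ⊖-≥ 2≤4N ⟨
  (4 ℕ.* N l) ⊖ 2         ≡⟨ m-n≡m⊖n (4 ℕ.* N l) 2 ⟨
  + (4 ℕ.* N l) - + 2     ≡⟨ cong (_- + 2) (pos-* 4 (N l)) ⟩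
  + 4 * + N l - + 2       ∎
  where
  open ≡-Reasoning
  open +-*-Solver using (solve; _:=_; con; _:+_; _:*_)
  step : 4 ℕ.* N l ≡ 2 ℕ.+ N (suc l)
  step = solve 1 (λ m → con 4 :* (con 2 :+ m) := con 8 :+ con 4 :* m) refl (excess l)
  2≤4N : 2 ≤ 4 ℕ.* N l
  2≤4N = subst (2 ≤_) (sym step) (ℕ.m≤m+n 2 (N (suc l)))

theorem20 : (l : ℕ) → 1 ≤ l → + γ (FCN l) ≡ + 4 * + γ (FCN (l ∸ 1)) - + 2
theorem20 (suc l) _ =
  trans (cong +_ (γ-FCN (suc l)))
    (trans (N-recurrence l) (cong (λ n → + 4 * + n - + 2) (sym (γ-FCN l))))
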